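{- $$\sum_{\pi\in\mathcal{G}_O^{N}}q^{|\pi|}=\sum_{m\geq1}\frac{1}{(q;q)_m} \sum_{k=0}^{m-1}q^{(k+1)m-\binom{k+1}{2}} .$$
   Context: An overpartition is a finite non-increasing sequence of positive integers (its parts) in which the first occurrence of each number may be overlined (so for each size $t$ at most one part of size $t$ is overlined); the size of a part $t$ or $\overline{t}$ is $t$, and the weight $|\pi|$ is the sum of the sizes of the parts. $\mathcal{G}_O^{N}$ is the set of overpartitions in which at least one non-overlined part appears and the sizes of all non-overlined parts are greater than the sizes of all overlined parts (if any). Here $|q|<1$ (or $q$ is a formal variable), $(q;q)_m=\prod_{i=1}^{m}(1-q^i)$. -}

module Defs where

open import Data.Bool using (Bool; true; false; if_then_else_)
open import Data.Integer as ℤ using (ℤ; 0ℤ; 1ℤ)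
import Data.Integer.Properties as ℤ
open import Data.List using (List; []; _∷_; map; foldr; applyUpTo; zipWith)
open import Data.List.Membership.Propositional using (_∈_)
open import Data.List.Relation.Unary.All using (All)
open import Data.List.Relation.Unary.AllPairs using (AllPairs)
open import Data.List.Relation.Unary.Any using (Any)
open import Data.List.Relation.Unary.Unique.Propositional using (Unique)
open import Data.Nat using (ℕ; zero; suc; _∸_; _<_; _≤_; _≟_)
open import Data.Nat.ListAction using (sum)
open import Data.Product using (∃-syntax; _×_; _,_)
open import Function using (_∘_)
open import Relation.Binary.PropositionalEquality
  using (_≡_; _≢_; refl; sym; cong; cong₂; module ≡-Reasoning)
open import Relation.Nullary.Decidable using (⌊_⌋)

------------------------------------------------------------------------
-- Formal power series in q over ℤ; f n is the coefficient of q^n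

PowerSeries : Set
PowerSeries = ℕ → ℤ

infix  8 q^_
infixl 7 _⊗_
infixl 6 _⊖_

q^_ : ℕ → PowerSeries
(q^ e) n = if ⌊ n ≟ e ⌋ then 1ℤ else 0ℤ

_⊖_ : PowerSeries → PowerSeries → PowerSeries
(f ⊖ g) n = f n ℤ.- g n

∑ℤ : List ℤ → ℤ
∑ℤ = foldr ℤ._+_ 0ℤ

_⊗_ : PowerSeries → PowerSeries → PowerSeries
(f ⊗ g) n = ∑ℤ (applyUpTo (λ i → f i ℤ.* g (n ∸ i)) (suc n))

-- ∑< m F = F 0 + … + F (m - 1)
∑< : ℕ → (ℕ → PowerSeries) → PowerSeries
∑< m F n = ∑ℤ (applyUpTo (λ k → F k n) m)

-- (q;q)_m = ∏_{i=1}^m (1 - q^i)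
qPochhammer : ℕ → PowerSeries
qPochhammer zero    = q^ 0
qPochhammer (suc m) = qPochhammer m ⊗ (q^ 0 ⊖ q^ (suc m))

-- The reciprocal g = 1/f of a series with constant term 1, from
-- g₀ = 1 and gₙ₊₁ = - ∑_{i=0}^n fᵢ₊₁ gₙ₋ᵢ.  The list is gₙ , … , g₀,
-- split into its head and its tail.
recipCoeffs : PowerSeries → ℕ → ℤ × List ℤ
recipCoeffs f zero = 1ℤ , []
recipCoeffs f (suc n) with recipCoeffs f n
... | g , gs = ℤ.- ∑ℤ (zipWith ℤ._*_ (applyUpTo (f ∘ suc) (suc n)) (g ∷ gs)) , g ∷ gs

recip : PowerSeries → PowerSeries
recip f n with recipCoeffs f n
... | g , _ = g

private
  recipCoeffs-list : ∀ f n → let (g , gs) = recipCoeffs f n in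
                     g ∷ gs ≡ applyUpTo (λ i → recip f (n ∸ i)) (suc n)
  recipCoeffs-list f zero    = refl
  recipCoeffs-list f (suc n) = cong (recip f (suc n) ∷_) (recipCoeffs-list f n)

  zipWith-applyUpTo : ∀ (f g : ℕ → ℤ) n →
    zipWith ℤ._*_ (applyUpTo f n) (applyUpTo g n) ≡ applyUpTo (λ i → f i ℤ.* g i) n
  zipWith-applyUpTo f g zero    = refl
  zipWith-applyUpTo f g (suc n) =
    cong (f 0 ℤ.* g 0 ∷_) (zipWith-applyUpTo (f ∘ suc) (g ∘ suc) n)

  recip-suc : ∀ f n → recip f (suc n) ≡
    ℤ.- ∑ℤ (applyUpTo (λ i → f (suc i) ℤ.* recip f (n ∸ i)) (suc n))
  recip-suc f n = cong (ℤ.-_ ∘ ∑ℤ) (begin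
    zipWith ℤ._*_ (applyUpTo (f ∘ suc) (suc n)) _
      ≡⟨ cong (zipWith ℤ._*_ (applyUpTo (f ∘ suc) (suc n))) (recipCoeffs-list f n) ⟩
    zipWith ℤ._*_ (applyUpTo (f ∘ suc) (suc n)) (applyUpTo (λ i → recip f (n ∸ i)) (suc n))
      ≡⟨ zipWith-applyUpTo (f ∘ suc) (λ i → recip f (n ∸ i)) (suc n) ⟩
    applyUpTo (λ i → f (suc i) ℤ.* recip f (n ∸ i)) (suc n) ∎)
    where open ≡-Reasoning

⊗-recip : ∀ f → f 0 ≡ 1ℤ → ∀ n → (f ⊗ recip f) n ≡ (q^ 0) n
⊗-recip f f₀≡1 zero    rewrite f₀≡1 = refl
⊗-recip f f₀≡1 (suc n) = begin
  f 0 ℤ.* recip f (suc n) ℤ.+ s   ≡⟨ cong (λ c → c ℤ.* recip f (suc n) ℤ.+ s) f₀≡1 ⟩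
  1ℤ ℤ.* recip f (suc n) ℤ.+ s    ≡⟨ cong (ℤ._+ s) (ℤ.*-identityˡ (recip f (suc n))) ⟩
  recip f (suc n) ℤ.+ s           ≡⟨ cong (ℤ._+ s) (recip-suc f n) ⟩
  ℤ.- s ℤ.+ s                     ≡⟨ ℤ.+-inverseˡ s ⟩
  0ℤ                              ∎
  where
  open ≡-Reasoning
  s : ℤ
  s = ∑ℤ (applyUpTo (λ i → f (suc i) ℤ.* recip f (n ∸ i)) (suc n))

qPochhammer-0 : ∀ m → qPochhammer m 0 ≡ 1ℤ
qPochhammer-0 zero = refl
qPochhammer-0 (suc m) rewrite qPochhammer-0 m = refl

-- ∑[ P ] F ≐ S : the family (F i), i ranging over the set {i | P i}, is
-- summable as formal power series and its sum is S.  That is, for each n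
-- only finitely many members have a nonzero coefficient of q^n, and these
-- coefficients add up to S n.  The list xs is a finite set of indices
-- containing all those members.
∑[_]_≐_ : {I : Set} → (I → Set) → (I → PowerSeries) → PowerSeries → Set
∑[_]_≐_ {I} P F S = ∀ n → ∃[ xs ]
  Unique xs × All P xs × (∀ (i : I) → P i → F i n ≢ 0ℤ → i ∈ xs) ×
  S n ≡ ∑ℤ (map (λ i → F i n) xs)

------------------------------------------------------------------------
-- Overpartitions

record Part : Set where
  constructor part
  field
    size      : ℕ
    overlined : Bool

open Part public

-- AllPairs R relates each entry to every later one, so first-overlined
-- says that an overlined part is the first one of its size.
record IsOverpartition (π : List Part) : Set where
  field
    positive        : All (λ x → 1 ≤ size x) π
    nonincreasing   : AllPairs (λ x y → size y ≤ size x) π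
    first-overlined : AllPairs (λ x y → overlined y ≡ true → size x ≢ size y) π

∣_∣ : List Part → ℕ
∣ π ∣ = sum (map size π)

record G-O-N (π : List Part) : Set where
  field
    isOverpartition  : IsOverpartition π
    has-nonoverlined : Any (λ x → overlined x ≡ false) π
    nonoverlined>overlined : ∀ {x y} → x ∈ π → y ∈ π →
      overlined x ≡ false → overlined y ≡ true → size y < size x

{-# OPTIONS --safe #-}
module Submission where

-- Let G m be the generating function of the overpartitions in question with
-- exactly m parts, and R m = 1/(q;q)_m that of the partitions with m parts
-- where the part 0 is allowed.  Subtracting 1 from every part of an
-- overpartition counted by G (m + 1) leaves another one of these, or an overlined 0
-- together with an overpartition counted by G m, or a non-overlined 0, in which
-- case no part is overlined and the others are counted by R m.  Hence
--   G (m + 1) = q^(m+1) (G (m + 1) + G m + R m),   G 0 = 0.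
-- The m-th summand of the right-hand side satisfies the same recurrence,
-- because N m = ∑_{k<m} q^((k+1)m - C(k+1,2)) has N (m + 1) = q^(m+1) (1 + N m)
-- and R (m + 1) = R m + q^(m+1) R (m + 1).

open import Defs
open import Data.Nat using (ℕ; suc; _+_; _*_; _∸_; _≤_)
open import Data.Nat.Combinatorics using (_C_)
open import Data.Product using (∃-syntax; _×_)
open import Data.Bool using (true; false; if_then_else_)
open import Data.Empty using (⊥; ⊥-elim)
open import Data.Integer as ℤ using (ℤ; 0ℤ; 1ℤ)
import Data.Integer.Properties as ℤ
open import Data.Integer.Tactic.RingSolver using (solve-∀)
open import Data.List using (List; []; _∷_; _++_; map; length; reverse; applyDownFrom)
import Data.List.Properties as List
open import Data.List.Membership.Propositional using (_∈_)
import Data.List.Membership.Propositional.Properties as ∈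
open import Data.List.Relation.Binary.Permutation.Propositional using (↭-sym)
import Data.List.Relation.Binary.Permutation.Propositional.Properties as ↭
open import Data.List.Relation.Unary.All as All using (All; []; _∷_)
import Data.List.Relation.Unary.All.Properties as All
open import Data.List.Relation.Unary.AllPairs as AllPairs using (AllPairs; []; _∷_)
import Data.List.Relation.Unary.AllPairs.Properties as AllPairs
open import Data.List.Relation.Unary.Any using (Any; here; there)
import Data.List.Relation.Unary.Any.Properties as Any
open import Data.List.Relation.Unary.Unique.Propositional using (Unique)
import Data.List.Relation.Unary.Unique.Propositional.Properties as Unique
open import Data.Nat using (zero; _<_; z≤n; s≤s; s≤s⁻¹; _≟_; _≤?_)
import Data.Nat.Combinatorics as ℕ
open import Data.Nat.Induction using (<-rec)
open import Data.Nat.ListAction.Properties using (sum-↭)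
import Data.Nat.Properties as ℕ
open import Data.Product using (_,_; proj₁; proj₂)
open import Data.Sum using (_⊎_; inj₁; inj₂)
open import Function using (_∘_; flip; case_of_)
open import Relation.Binary.PropositionalEquality
  using (_≡_; _≢_; _≗_; _→-setoid_; refl; sym; trans; cong; cong₂; subst; module ≡-Reasoning)
open import Relation.Nullary using (yes; no; contradiction)
open import Relation.Nullary.Decidable using (isYes≗does)
import Relation.Binary.Reasoning.Setoid as ≈-Reasoning

-- Power series

infixl 6 _⊕_

_⊕_ : PowerSeries → PowerSeries → PowerSeries
(f ⊕ g) n = f n ℤ.+ g n

private
  module ≗-Reasoning = ≈-Reasoning (ℕ →-setoid ℤ)

  variable
    f f′ g g′ : PowerSeries

-- `(f ⊗ g) (suc n)` is definitionally `f 0 ℤ.* g (suc n) ℤ.+ ((f ∘ suc) ⊗ g) n`. The inductions on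
-- the degree below rest on this unfolding and let the left factor vary.
⊗-cong : f ≗ f′ → g ≗ g′ → f ⊗ g ≗ f′ ⊗ g′
⊗-cong p q zero    = cong (ℤ._+ 0ℤ) (cong₂ ℤ._*_ (p 0) (q 0))
⊗-cong p q (suc n) = cong₂ ℤ._+_ (cong₂ ℤ._*_ (p 0) (q (suc n))) (⊗-cong (p ∘ suc) q n)

⊗-congˡ : ∀ f → g ≗ g′ → f ⊗ g ≗ f ⊗ g′
⊗-congˡ f = ⊗-cong {f = f} (λ _ → refl)

⊗-congʳ : ∀ g → f ≗ f′ → f ⊗ g ≗ f′ ⊗ g
⊗-congʳ g p = ⊗-cong {g = g} p (λ _ → refl)

⊗-zeroˡ : ∀ f → (λ _ → 0ℤ) ⊗ f ≗ λ _ → 0ℤ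
⊗-zeroˡ f zero    = refl
⊗-zeroˡ f (suc n) = trans (ℤ.+-identityˡ _) (⊗-zeroˡ f n)

⊗-identityˡ : ∀ f → q^ 0 ⊗ f ≗ f
⊗-identityˡ f zero    = trans (ℤ.+-identityʳ _) (ℤ.*-identityˡ _)
⊗-identityˡ f (suc n) = begin
  1ℤ ℤ.* f (suc n) ℤ.+ ((λ _ → 0ℤ) ⊗ f) n  ≡⟨ cong₂ ℤ._+_ (ℤ.*-identityˡ (f (suc n))) (⊗-zeroˡ f n) ⟩
  f (suc n) ℤ.+ 0ℤ                          ≡⟨ ℤ.+-identityʳ _ ⟩
  f (suc n)                                 ∎
  where open ≡-Reasoning

-- The product unfolds along its left factor only. So the leading term of `f` is peeled off, the
-- rest commuted, and the leading term of `g` peeled off; this drops the degree by two and leaves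
-- `f ∘ suc` and `g ∘ suc`. Hence the two base cases.
⊗-comm : ∀ f g → f ⊗ g ≗ g ⊗ f
⊗-comm f g zero          = cong (ℤ._+ 0ℤ) (ℤ.*-comm (f 0) (g 0))
⊗-comm f g (suc zero)    = swap (f 0) (f 1) (g 0) (g 1)
  where
  swap : ∀ a b c d → a ℤ.* d ℤ.+ (b ℤ.* c ℤ.+ 0ℤ) ≡ c ℤ.* b ℤ.+ (d ℤ.* a ℤ.+ 0ℤ)
  swap = solve-∀
⊗-comm f g (suc (suc n)) = begin
  f 0 ℤ.* g (suc (suc n)) ℤ.+ ((f ∘ suc) ⊗ g) (suc n)
    ≡⟨ cong (λ s → f 0 ℤ.* g (suc (suc n)) ℤ.+ s) (⊗-comm (f ∘ suc) g (suc n)) ⟩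
  f 0 ℤ.* g (suc (suc n)) ℤ.+ (g 0 ℤ.* f (suc (suc n)) ℤ.+ ((g ∘ suc) ⊗ (f ∘ suc)) n)
    ≡⟨ cong (λ s → f 0 ℤ.* g (suc (suc n)) ℤ.+ (g 0 ℤ.* f (suc (suc n)) ℤ.+ s))
            (⊗-comm (g ∘ suc) (f ∘ suc) n) ⟩
  f 0 ℤ.* g (suc (suc n)) ℤ.+ (g 0 ℤ.* f (suc (suc n)) ℤ.+ ((f ∘ suc) ⊗ (g ∘ suc)) n)
    ≡⟨ swap (f 0) (g (suc (suc n))) (g 0) (f (suc (suc n))) _ ⟩
  g 0 ℤ.* f (suc (suc n)) ℤ.+ (f 0 ℤ.* g (suc (suc n)) ℤ.+ ((f ∘ suc) ⊗ (g ∘ suc)) n)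
    ≡⟨ cong (λ s → g 0 ℤ.* f (suc (suc n)) ℤ.+ s) (⊗-comm f (g ∘ suc) (suc n)) ⟩
  g 0 ℤ.* f (suc (suc n)) ℤ.+ ((g ∘ suc) ⊗ f) (suc n) ∎
  where
  open ≡-Reasoning
  swap : ∀ a b c d s → a ℤ.* b ℤ.+ (c ℤ.* d ℤ.+ s) ≡ c ℤ.* d ℤ.+ (a ℤ.* b ℤ.+ s)
  swap = solve-∀

⊗-distribʳ-⊕ : ∀ f g h → (f ⊕ g) ⊗ h ≗ f ⊗ h ⊕ g ⊗ h
⊗-distribʳ-⊕ f g h zero    = distrib (f 0) (g 0) (h 0)
  where
  distrib : ∀ a b c → (a ℤ.+ b) ℤ.* c ℤ.+ 0ℤ ≡ a ℤ.* c ℤ.+ 0ℤ ℤ.+ (b ℤ.* c ℤ.+ 0ℤ)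
  distrib = solve-∀
⊗-distribʳ-⊕ f g h (suc n) = trans
  (cong (λ s → (f 0 ℤ.+ g 0) ℤ.* h (suc n) ℤ.+ s) (⊗-distribʳ-⊕ (f ∘ suc) (g ∘ suc) h n))
  (distrib (f 0) (g 0) (h (suc n)) (((f ∘ suc) ⊗ h) n) (((g ∘ suc) ⊗ h) n))
  where
  distrib : ∀ a b c s t → (a ℤ.+ b) ℤ.* c ℤ.+ (s ℤ.+ t) ≡ a ℤ.* c ℤ.+ s ℤ.+ (b ℤ.* c ℤ.+ t)
  distrib = solve-∀

⊗-distribˡ-⊕ : ∀ f g h → f ⊗ (g ⊕ h) ≗ f ⊗ g ⊕ f ⊗ h
⊗-distribˡ-⊕ f g h n = begin
  (f ⊗ (g ⊕ h)) n          ≡⟨ ⊗-comm f (g ⊕ h) n ⟩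
  ((g ⊕ h) ⊗ f) n          ≡⟨ ⊗-distribʳ-⊕ g h f n ⟩
  (g ⊗ f ⊕ h ⊗ f) n        ≡⟨ cong₂ ℤ._+_ (⊗-comm g f n) (⊗-comm h f n) ⟩
  (f ⊗ g ⊕ f ⊗ h) n        ∎
  where open ≡-Reasoning

⊗-scaleˡ : ∀ c f g → (λ n → c ℤ.* f n) ⊗ g ≗ λ n → c ℤ.* (f ⊗ g) n
⊗-scaleˡ c f g zero    = scale c (f 0) (g 0)
  where
  scale : ∀ a b c → a ℤ.* b ℤ.* c ℤ.+ 0ℤ ≡ a ℤ.* (b ℤ.* c ℤ.+ 0ℤ)
  scale = solve-∀
⊗-scaleˡ c f g (suc n) = trans
  (cong (λ s → c ℤ.* f 0 ℤ.* g (suc n) ℤ.+ s) (⊗-scaleˡ c (f ∘ suc) g n))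
  (scale c (f 0) (g (suc n)) (((f ∘ suc) ⊗ g) n))
  where
  scale : ∀ a b c s → a ℤ.* b ℤ.* c ℤ.+ a ℤ.* s ≡ a ℤ.* (b ℤ.* c ℤ.+ s)
  scale = solve-∀

⊗-assoc : ∀ f g h → (f ⊗ g) ⊗ h ≗ f ⊗ (g ⊗ h)
⊗-assoc f g h zero    = assoc (f 0) (g 0) (h 0)
  where
  assoc : ∀ a b c → (a ℤ.* b ℤ.+ 0ℤ) ℤ.* c ℤ.+ 0ℤ ≡ a ℤ.* (b ℤ.* c ℤ.+ 0ℤ) ℤ.+ 0ℤ
  assoc = solve-∀
⊗-assoc f g h (suc n) = begin
  (f 0 ℤ.* g 0 ℤ.+ 0ℤ) ℤ.* h (suc n) ℤ.+
    (((λ i → f 0 ℤ.* g (suc i)) ⊕ (f ∘ suc) ⊗ g) ⊗ h) n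
    -- The tail of `f ⊗ g` is a scaled tail of `g` plus `(f ∘ suc) ⊗ g`, so distributivity and
    -- scaling reduce the claim to a smaller degree.
    ≡⟨ cong (λ s → (f 0 ℤ.* g 0 ℤ.+ 0ℤ) ℤ.* h (suc n) ℤ.+ s) (begin
        (((λ i → f 0 ℤ.* g (suc i)) ⊕ (f ∘ suc) ⊗ g) ⊗ h) n
          ≡⟨ ⊗-distribʳ-⊕ (λ i → f 0 ℤ.* g (suc i)) ((f ∘ suc) ⊗ g) h n ⟩
        ((λ i → f 0 ℤ.* g (suc i)) ⊗ h) n ℤ.+ (((f ∘ suc) ⊗ g) ⊗ h) n
          ≡⟨ cong₂ ℤ._+_ (⊗-scaleˡ (f 0) (g ∘ suc) h n) (⊗-assoc (f ∘ suc) g h n) ⟩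
        f 0 ℤ.* ((g ∘ suc) ⊗ h) n ℤ.+ ((f ∘ suc) ⊗ (g ⊗ h)) n ∎) ⟩
  (f 0 ℤ.* g 0 ℤ.+ 0ℤ) ℤ.* h (suc n) ℤ.+
    (f 0 ℤ.* ((g ∘ suc) ⊗ h) n ℤ.+ ((f ∘ suc) ⊗ (g ⊗ h)) n)
    ≡⟨ assoc (f 0) (g 0) (h (suc n)) _ _ ⟩
  f 0 ℤ.* (g 0 ℤ.* h (suc n) ℤ.+ ((g ∘ suc) ⊗ h) n) ℤ.+ ((f ∘ suc) ⊗ (g ⊗ h)) n ∎
  where
  open ≡-Reasoning
  assoc : ∀ a b c s t → (a ℤ.* b ℤ.+ 0ℤ) ℤ.* c ℤ.+ (a ℤ.* s ℤ.+ t) ≡ a ℤ.* (b ℤ.* c ℤ.+ s) ℤ.+ t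
  assoc = solve-∀

⊗-exchange : ∀ f g h → f ⊗ (g ⊗ h) ≗ g ⊗ (f ⊗ h)
⊗-exchange f g h = begin
  f ⊗ (g ⊗ h)  ≈⟨ ⊗-assoc f g h ⟨
  (f ⊗ g) ⊗ h  ≈⟨ ⊗-congʳ h (⊗-comm f g) ⟩
  (g ⊗ f) ⊗ h  ≈⟨ ⊗-assoc g f h ⟩
  g ⊗ (f ⊗ h)  ∎
  where open ≗-Reasoning

-- Monomials

q^-suc : ∀ e n → (q^ suc e) (suc n) ≡ (q^ e) n
q^-suc e n = cong (λ b → if b then 1ℤ else 0ℤ)
  -- The two decisions have definitionally equal `does`, which `isYes≗does` exposes.
  (trans (isYes≗does (suc n ≟ suc e)) (sym (isYes≗does (n ≟ e))))

q^-self : ∀ n → (q^ n) n ≡ 1ℤ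
q^-self zero    = refl
q^-self (suc n) = trans (q^-suc n n) (q^-self n)

q^-≢0 : ∀ {e n} → (q^ e) n ≢ 0ℤ → e ≡ n
q^-≢0 {e} {n} ≢0 with n ≟ e
... | yes refl = refl
... | no  _    = contradiction refl ≢0

q^⊗-suc : ∀ d f n → (q^ suc d ⊗ f) (suc n) ≡ (q^ d ⊗ f) n
q^⊗-suc d f n = trans (ℤ.+-identityˡ _) (⊗-congʳ f (q^-suc d) n)

q^⊗-+ : ∀ d f n → (q^ d ⊗ f) (d + n) ≡ f n
q^⊗-+ zero    f n = ⊗-identityˡ f n
q^⊗-+ (suc d) f n = trans (q^⊗-suc d f (d + n)) (q^⊗-+ d f n)

q^⊗-< : ∀ d f {n} → n < d → (q^ d ⊗ f) n ≡ 0ℤ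
q^⊗-< (suc d) f {zero}  _         = refl
q^⊗-< (suc d) f {suc n} (s≤s n<d) = trans (q^⊗-suc d f n) (q^⊗-< d f n<d)

q^-+ : ∀ d e → q^ (d + e) ≗ q^ d ⊗ q^ e
q^-+ zero    e n       = sym (⊗-identityˡ (q^ e) n)
q^-+ (suc d) e zero    = refl
q^-+ (suc d) e (suc n) = trans (q^-suc (d + e) n) (trans (q^-+ d e n) (sym (q^⊗-suc d (q^ e) n)))

-- Finite sums and reciprocals

∑<-cong : ∀ m {F G : ℕ → PowerSeries} → (∀ k → k < m → F k ≗ G k) → ∑< m F ≗ ∑< m G
∑<-cong zero    p n = refl
∑<-cong (suc m) p n =
  cong₂ ℤ._+_ (p 0 (s≤s z≤n) n) (∑<-cong m (λ k k<m → p (suc k) (s≤s k<m)) n)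

⊗-∑< : ∀ f m F → f ⊗ ∑< m F ≗ ∑< m (λ k → f ⊗ F k)
⊗-∑< f zero    F n = trans (⊗-comm f (λ _ → 0ℤ) n) (⊗-zeroˡ f n)
⊗-∑< f (suc m) F n = trans (⊗-distribˡ-⊕ f (F 0) (∑< m (F ∘ suc)) n)
                           (cong (λ s → (f ⊗ F 0) n ℤ.+ s) (⊗-∑< f m (F ∘ suc) n))

recip-1 : recip (q^ 0) ≗ q^ 0
recip-1 n = trans (sym (⊗-identityˡ (recip (q^ 0)) n)) (⊗-recip (q^ 0) refl n)

[1-f]⊗ : ∀ f g → (q^ 0 ⊖ f) ⊗ g ⊕ f ⊗ g ≗ g
[1-f]⊗ f g = begin
  (q^ 0 ⊖ f) ⊗ g ⊕ f ⊗ g  ≈⟨ ⊗-distribʳ-⊕ (q^ 0 ⊖ f) f g ⟨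
  ((q^ 0 ⊖ f) ⊕ f) ⊗ g    ≈⟨ ⊗-congʳ g (λ n → cancel ((q^ 0) n) (f n)) ⟩
  q^ 0 ⊗ g                ≈⟨ ⊗-identityˡ g ⟩
  g                       ∎
  where
  open ≗-Reasoning
  cancel : ∀ a b → a ℤ.- b ℤ.+ b ≡ a
  cancel = solve-∀

1/qPochhammer : ℕ → PowerSeries
1/qPochhammer m = recip (qPochhammer m)

-- Both `R` and `(1 - q^(m+1)) R′` are inverses of `Q`, hence equal; adding `q^(m+1) R′` to both
-- gives the recurrence.
1/qPochhammer-suc : ∀ m →
  1/qPochhammer (suc m) ≗ 1/qPochhammer m ⊕ q^ suc m ⊗ 1/qPochhammer (suc m)
1/qPochhammer-suc m n = trans (sym ([1-f]⊗ (q^ suc m) R′ n))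
                              (cong (ℤ._+ (q^ suc m ⊗ R′) n) (step n))
  where
  Q = qPochhammer m
  R = 1/qPochhammer m
  R′ = 1/qPochhammer (suc m)
  u = q^ 0 ⊖ q^ suc m
  open ≗-Reasoning
  step : u ⊗ R′ ≗ R
  step = begin
    u ⊗ R′              ≈⟨ ⊗-identityˡ (u ⊗ R′) ⟨
    -- The unit is replaced by `Q ⊗ R`, so that `Q` can be moved next to `u` to complete
    -- `qPochhammer (suc m)`.
    q^ 0 ⊗ (u ⊗ R′)     ≈⟨ ⊗-congʳ (u ⊗ R′) (⊗-recip Q (qPochhammer-0 m)) ⟨
    (Q ⊗ R) ⊗ (u ⊗ R′)  ≈⟨ ⊗-congʳ (u ⊗ R′) (⊗-comm Q R) ⟩
    (R ⊗ Q) ⊗ (u ⊗ R′)  ≈⟨ ⊗-assoc R Q (u ⊗ R′) ⟩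
    R ⊗ (Q ⊗ (u ⊗ R′))  ≈⟨ ⊗-congˡ R (⊗-assoc Q u R′) ⟨
    R ⊗ ((Q ⊗ u) ⊗ R′)  ≈⟨ ⊗-congˡ R (⊗-recip (Q ⊗ u) (qPochhammer-0 (suc m))) ⟩
    R ⊗ q^ 0            ≈⟨ ⊗-comm R (q^ 0) ⟩
    q^ 0 ⊗ R            ≈⟨ ⊗-identityˡ R ⟩
    R                   ∎

-- The summands of the right-hand side and their recurrence

exponent : ℕ → ℕ → ℕ
exponent m k = (k + 1) * m ∸ (k + 1) C 2

numerator : ℕ → PowerSeries
numerator m = ∑< m (λ k → q^ exponent m k)

-- This makes the truncated subtraction in `exponent` a genuine one. Raising `k` by one adds
-- `k + 1 ≤ m` on the left, by Pascal's rule, and `m` on the right.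
[k+1]C2≤[k+1]m : ∀ m k → k ≤ m → (k + 1) C 2 ≤ (k + 1) * m
[k+1]C2≤[k+1]m m zero    _   = z≤n
[k+1]C2≤[k+1]m m (suc k) k<m = begin
  suc (k + 1) C 2            ≡⟨ ℕ.nCk+nC[k+1]≡[n+1]C[k+1] (k + 1) 1 ⟨
  (k + 1) C 1 + (k + 1) C 2  ≡⟨ cong (_+ (k + 1) C 2) (ℕ.nC1≡n (k + 1)) ⟩
  k + 1 + (k + 1) C 2        ≤⟨ ℕ.+-mono-≤ (subst (_≤ m) (ℕ.+-comm 1 k) k<m)
                                           ([k+1]C2≤[k+1]m m k (ℕ.<⇒≤ k<m)) ⟩
  m + (k + 1) * m            ∎
  where open ℕ.≤-Reasoning

-- The product becomes `(m+1) + (k+1) + (k+1)m`, and Pascal's rule turns the binomial coefficient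
-- into `(k+1) + C(k+1,2)`; the two copies of `k+1` cancel.
exponent-suc : ∀ m k → k ≤ m → exponent (suc m) (suc k) ≡ suc m + exponent m k
exponent-suc m k k≤m = begin
  (suc m + (k + 1) * suc m) ∸ suc (k + 1) C 2
    ≡⟨ cong (suc m + (k + 1) * suc m ∸_) (ℕ.nCk+nC[k+1]≡[n+1]C[k+1] (k + 1) 1) ⟨
  (suc m + (k + 1) * suc m) ∸ ((k + 1) C 1 + (k + 1) C 2)
    ≡⟨ cong₂ (λ a b → (suc m + a) ∸ (b + (k + 1) C 2)) (ℕ.*-suc (k + 1) m) (ℕ.nC1≡n (k + 1)) ⟩
  (suc m + (k + 1 + (k + 1) * m)) ∸ (k + 1 + (k + 1) C 2)
    ≡⟨ cong (_∸ (k + 1 + (k + 1) C 2)) (begin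
        suc m + (k + 1 + (k + 1) * m)    ≡⟨ ℕ.+-assoc (suc m) (k + 1) _ ⟨
        (suc m + (k + 1)) + (k + 1) * m  ≡⟨ cong (_+ (k + 1) * m) (ℕ.+-comm (suc m) (k + 1)) ⟩
        (k + 1 + suc m) + (k + 1) * m    ≡⟨ ℕ.+-assoc (k + 1) (suc m) _ ⟩
        k + 1 + (suc m + (k + 1) * m)    ∎) ⟩
  (k + 1 + (suc m + (k + 1) * m)) ∸ (k + 1 + (k + 1) C 2)
    ≡⟨ ℕ.[m+n]∸[m+o]≡n∸o (k + 1) _ _ ⟩
  (suc m + (k + 1) * m) ∸ (k + 1) C 2
    ≡⟨ ℕ.+-∸-assoc (suc m) ([k+1]C2≤[k+1]m m k k≤m) ⟩
  suc m + exponent m k ∎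
  where open ≡-Reasoning

numerator-suc : ∀ m → numerator (suc m) ≗ q^ suc m ⊗ (q^ 0 ⊕ numerator m)
numerator-suc m = begin
  -- For `k = 0` the exponent reduces to `suc m + 0`, because `1 C 2` is 0. The other terms are
  -- reindexed by `suc k`.
  q^ (suc m + 0) ⊕ ∑< m (λ k → q^ exponent (suc m) (suc k))
    ≈⟨ (λ n → cong₂ ℤ._+_ (q^-+ (suc m) 0 n) (∑<-cong m shift n)) ⟩
  q^ suc m ⊗ q^ 0 ⊕ ∑< m (λ k → q^ suc m ⊗ q^ exponent m k)
    ≈⟨ (λ n → cong (λ s → (q^ suc m ⊗ q^ 0) n ℤ.+ s) (⊗-∑< (q^ suc m) m (λ k → q^ exponent m k) n)) ⟨
  q^ suc m ⊗ q^ 0 ⊕ q^ suc m ⊗ numerator m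
    ≈⟨ ⊗-distribˡ-⊕ (q^ suc m) (q^ 0) (numerator m) ⟨
  q^ suc m ⊗ (q^ 0 ⊕ numerator m) ∎
  where
  open ≗-Reasoning
  shift : ∀ k → k < m → q^ exponent (suc m) (suc k) ≗ q^ suc m ⊗ q^ exponent m k
  shift k k<m n = trans (cong (λ e → (q^ e) n) (exponent-suc m k (ℕ.<⇒≤ k<m)))
                        (q^-+ (suc m) (exponent m k) n)

summand : ℕ → PowerSeries
summand m = 1/qPochhammer m ⊗ numerator m

summand-0 : ∀ n → summand 0 n ≡ 0ℤ
summand-0 n = trans (⊗-comm (1/qPochhammer 0) (λ _ → 0ℤ) n) (⊗-zeroˡ (1/qPochhammer 0) n)

-- `R′ = R + d R′` splits the product `R′ N′`. Only in the part `R N′` is `N′` then expanded as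
-- `d (1 + N)`.
summand-suc : ∀ m → summand (suc m) ≗
  q^ suc m ⊗ (summand (suc m) ⊕ (summand m ⊕ 1/qPochhammer m))
summand-suc m = begin
  R′ ⊗ N′
    ≈⟨ ⊗-congʳ N′ (1/qPochhammer-suc m) ⟩
  (R ⊕ d ⊗ R′) ⊗ N′
    ≈⟨ ⊗-distribʳ-⊕ R (d ⊗ R′) N′ ⟩
  R ⊗ N′ ⊕ (d ⊗ R′) ⊗ N′
    ≈⟨ (λ n → cong₂ ℤ._+_ (head n) (⊗-assoc d R′ N′ n)) ⟩
  d ⊗ (summand m ⊕ R) ⊕ d ⊗ (R′ ⊗ N′)
    ≈⟨ (λ n → ℤ.+-comm ((d ⊗ (summand m ⊕ R)) n) _) ⟩
  d ⊗ (R′ ⊗ N′) ⊕ d ⊗ (summand m ⊕ R)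
    ≈⟨ ⊗-distribˡ-⊕ d (R′ ⊗ N′) (summand m ⊕ R) ⟨
  d ⊗ (R′ ⊗ N′ ⊕ (summand m ⊕ R)) ∎
  where
  open ≗-Reasoning
  d = q^ suc m
  R = 1/qPochhammer m
  R′ = 1/qPochhammer (suc m)
  N = numerator m
  N′ = numerator (suc m)
  head : R ⊗ N′ ≗ d ⊗ (summand m ⊕ R)
  head = begin
    R ⊗ N′                ≈⟨ ⊗-congˡ R (numerator-suc m) ⟩
    R ⊗ (d ⊗ (q^ 0 ⊕ N))  ≈⟨ ⊗-exchange R d (q^ 0 ⊕ N) ⟩
    d ⊗ (R ⊗ (q^ 0 ⊕ N))  ≈⟨ ⊗-congˡ d (⊗-distribˡ-⊕ R (q^ 0) N) ⟩
    d ⊗ (R ⊗ q^ 0 ⊕ R ⊗ N)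
      ≈⟨ ⊗-congˡ d (λ n → trans (cong (ℤ._+ (R ⊗ N) n)
                                  (trans (⊗-comm R (q^ 0) n) (⊗-identityˡ R n)))
                                (ℤ.+-comm (R n) ((R ⊗ N) n))) ⟩
    d ⊗ (R ⊗ N ⊕ R)       ∎

-- The recurrence shows the factor `q^m`. This makes the sum over `m` locally finite.
summand-< : ∀ {m n} → n < m → summand m n ≡ 0ℤ
summand-< {suc m} {n} n<m = trans (summand-suc m n) 
  (q^⊗-< (suc m) (summand (suc m) ⊕ (summand m ⊕ 1/qPochhammer m)) n<m)

-- Cardinalities

-- The cardinality is an integer so that it can be given directly as a coefficient of a power
-- series.
HasCard : {A : Set} → (A → Set) → ℤ → Set
HasCard P c = ∃[ xs ] Unique xs × (∀ {x} → x ∈ xs → P x) × (∀ {x} → P x → x ∈ xs) ×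
              ℤ.+ length xs ≡ c

module _ {A : Set} {P : A → Set} where

  card-∅ : (∀ {x} → P x → ⊥) → HasCard P 0ℤ
  card-∅ ¬P = [] , [] , (λ ()) , (λ p → ⊥-elim (¬P p)) , refl

  card-singleton : ∀ x → P x → (∀ {y} → P y → y ≡ x) → HasCard P 1ℤ
  card-singleton x px uniq =
    x ∷ [] , [] ∷ [] , (λ { (here refl) → px }) , (λ p → here (uniq p)) , refl

  card-⊎ : {Q T : A → Set} {a b : ℤ} → HasCard P a → HasCard Q b →
           (∀ {x} → P x → Q x → ⊥) →
           (∀ {x} → P x → T x) → (∀ {x} → Q x → T x) → (∀ {x} → T x → P x ⊎ Q x) →
           HasCard T (a ℤ.+ b)
  card-⊎ (xs , xs! , xs⊆ , ⊆xs , |xs|) (ys , ys! , ys⊆ , ⊆ys , |ys|) disj P⊆ Q⊆ T⊆ =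
    xs ++ ys ,
    Unique.++⁺ xs! ys! (λ (∈xs , ∈ys) → disj (xs⊆ ∈xs) (ys⊆ ∈ys)) ,
    (λ x∈ → case ∈.∈-++⁻ xs x∈ of λ { (inj₁ ∈xs) → P⊆ (xs⊆ ∈xs) ; (inj₂ ∈ys) → Q⊆ (ys⊆ ∈ys) }) ,
    (λ t → case T⊆ t of λ { (inj₁ p) → ∈.∈-++⁺ˡ (⊆xs p) ; (inj₂ q) → ∈.∈-++⁺ʳ xs (⊆ys q) }) ,
    trans (cong ℤ.+_ (List.length-++ xs)) (cong₂ ℤ._+_ |xs| |ys|)

  card-map : {B : Set} {Q : B → Set} {c : ℤ} (f : A → B) → (∀ {x y} → f x ≡ f y → x ≡ y) →
             (∀ {x} → P x → Q (f x)) → (∀ {y} → Q y → ∃[ x ] P x × f x ≡ y) →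
             HasCard P c → HasCard Q c
  card-map {Q = Q} f inj P⊆ Q⊆ (xs , xs! , xs⊆ , ⊆xs , |xs|) =
    map f xs ,
    Unique.map⁺ inj xs! ,
    (λ y∈ → let (x , x∈ , y≡) = ∈.∈-map⁻ f y∈ in subst Q (sym y≡) (P⊆ (xs⊆ x∈))) ,
    (λ q → let (x , p , fx≡) = Q⊆ q in subst (_∈ map f xs) fx≡ (∈.∈-map⁺ f (⊆xs p))) ,
    trans (cong ℤ.+_ (List.length-map f xs)) |xs|

-- Lists of parts, smallest part first

_at_ : (List Part → Set) → ℕ → List Part → Set
(P at n) π = P π × ∣ π ∣ ≡ n

Image : (List Part → List Part) → (List Part → Set) → List Part → Set
Image f P ρ = ∃[ π ] P π × f π ≡ ρ

card-image : ∀ {P d n c} f → (∀ {π ρ} → f π ≡ f ρ → π ≡ ρ) →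
  (∀ {π} → P π → ∣ f π ∣ ≡ d + ∣ π ∣) →
  HasCard (P at n) c → HasCard (Image f P at (d + n)) c
card-image {d = d} f inj weight = card-map f inj
  (λ (p , |π|) → (_ , p , refl) , trans (weight p) (cong (d +_) |π|))
  (λ { ((π , p , refl) , |fπ|) →
       π , (p , ℕ.+-cancelˡ-≡ d _ _ (trans (sym (weight p)) |fπ|)) , refl })

-- An injection that adds `d` to every weight multiplies the generating function by `q^d`. The
-- hypothesis `card` is asked only at `n′` with `n ≡ d + n′`, so that a well-founded recursion on
-- the weight can supply it.
card-shifted : ∀ {P d} c f → (∀ {π ρ} → f π ≡ f ρ → π ≡ ρ) →
  (∀ {π} → P π → ∣ f π ∣ ≡ d + ∣ π ∣) →
  ∀ n → (∀ n′ → n ≡ d + n′ → HasCard (P at n′) (c n′)) →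
  HasCard (Image f P at n) ((q^ d ⊗ c) n)
card-shifted {P} {d} c f inj weight n card with d ≤? n
... | no d≰n = subst (HasCard (Image f P at n)) (sym (q^⊗-< d c (ℕ.≰⇒> d≰n)))
  (card-∅ λ { ((π , p , refl) , |fπ|) →
    d≰n (subst (d ≤_) (trans (sym (weight p)) |fπ|) (ℕ.m≤m+n d ∣ π ∣)) })
-- Abstracting `n ∸ d` along with the equation lets `refl` replace `n` by `d + n′`.
... | yes d≤n with n ∸ d | sym (ℕ.m+[n∸m]≡n d≤n)
...   | n′ | refl = subst (HasCard (Image f P at n)) (sym (q^⊗-+ d c n′))
  (card-image {P = P} {d = d} f inj weight (card n′ refl))

-- Adding 1 to every part

grow : Part → Part
grow (part s b) = part (suc s) b

grow-injective : ∀ {x y} → grow x ≡ grow y → x ≡ y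
grow-injective refl = refl

grow-all : List Part → List Part
grow-all = map grow

∣grow-all∣ : ∀ π → ∣ grow-all π ∣ ≡ length π + ∣ π ∣
∣grow-all∣ []      = refl
∣grow-all∣ (x ∷ π) = cong suc (begin
  size x + ∣ grow-all π ∣         ≡⟨ cong (size x +_) (∣grow-all∣ π) ⟩
  size x + (length π + ∣ π ∣)     ≡⟨ ℕ.+-assoc (size x) (length π) _ ⟨
  (size x + length π) + ∣ π ∣     ≡⟨ cong (_+ ∣ π ∣) (ℕ.+-comm (size x) (length π)) ⟩
  (length π + size x) + ∣ π ∣     ≡⟨ ℕ.+-assoc (length π) (size x) _ ⟩
  length π + (size x + ∣ π ∣)     ∎)
  where open ≡-Reasoning

Positive NonOverlined : Part → Set
Positive x = 1 ≤ size x
NonOverlined x = overlined x ≡ false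

grow-all-surjective : ∀ {π} → All Positive π → ∃[ ρ ] grow-all ρ ≡ π
grow-all-surjective [] = [] , refl
grow-all-surjective (_∷_ {part (suc s) b} _ pos) =
  let (ρ , eq) = grow-all-surjective pos in part s b ∷ ρ , cong (part (suc s) b ∷_) eq

-- x ⊴ y holds iff x may precede y in the reversal of a member of G_O^N.
record _⊴_ (x y : Part) : Set where
  field
    size-≤      : size x ≤ size y
    overlined-< : overlined x ≡ true → size x < size y
    overlined-⇐ : overlined y ≡ true → overlined x ≡ true

open _⊴_

Ascending : List Part → Set
Ascending = AllPairs _⊴_

Ascending-grow⁺ : ∀ {π} → Ascending π → Ascending (grow-all π)
Ascending-grow⁺ = AllPairs.map⁺ ∘ AllPairs.map λ x⊴y → record
  { size-≤      = s≤s (size-≤ x⊴y)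
  ; overlined-< = s≤s ∘ overlined-< x⊴y
  ; overlined-⇐ = overlined-⇐ x⊴y
  }

Ascending-grow⁻ : ∀ {π} → Ascending (grow-all π) → Ascending π
Ascending-grow⁻ = AllPairs.map (λ x⊴y → record
  { size-≤      = s≤s⁻¹ (size-≤ x⊴y)
  ; overlined-< = s≤s⁻¹ ∘ overlined-< x⊴y
  ; overlined-⇐ = overlined-⇐ x⊴y
  }) ∘ AllPairs.map⁻

OfLength : ℕ → (List Part → Set) → List Part → Set
OfLength m P π = length π ≡ m × P π

-- Sizes may be 0 in `Plain` and `Mixed`. `Plain` models partitions with zeros allowed,
-- `PositiveMixed` the reversals of members of G_O^N, and `Mixed` what these become when 1 is
-- subtracted from every part.
Plain Mixed PositiveMixed : List Part → Set
Plain π = Ascending π × All NonOverlined π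
Mixed π = Ascending π × Any NonOverlined π
PositiveMixed π = All Positive π × Mixed π

grow-all-injective : ∀ {π ρ} → grow-all π ≡ grow-all ρ → π ≡ ρ
grow-all-injective = List.map-injective grow-injective

positive-above : ∀ {x π} → Positive x → All (x ⊴_) π → All Positive π
positive-above pos = All.map (λ x⊴y → ℕ.≤-trans pos (size-≤ x⊴y))

image-grow : ∀ {m P} → (∀ {π} → P (grow-all π) → P π) →
  ∀ {π} → All Positive π → OfLength m P π → Image grow-all (OfLength m P) π
image-grow ungrow pos (len , p) with ρ , refl ← grow-all-surjective pos =
  ρ , (trans (sym (List.length-map grow ρ)) len , ungrow p) , refl

zero⊴ : ∀ {x} → NonOverlined x → part 0 false ⊴ x
zero⊴ non = record
  { size-≤ = z≤n ; overlined-< = λ () ; overlined-⇐ = λ over → trans (sym non) over }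

zero̅⊴ : ∀ {x} → Positive x → part 0 true ⊴ x
zero̅⊴ pos = record
  { size-≤ = z≤n ; overlined-< = λ _ → pos ; overlined-⇐ = λ _ → refl }

nonoverlined-above : ∀ {x π} → NonOverlined x → All (x ⊴_) π → All NonOverlined π
nonoverlined-above {x} non = All.map λ {y} x⊴y → below y x⊴y
  where
  below : ∀ y → x ⊴ y → NonOverlined y
  below (part _ false) _   = refl
  below (part _ true)  x⊴y with () ← trans (sym non) (overlined-⇐ x⊴y refl)

-- Counting by length and weight

-- Either the smallest part is 0 and can be removed, or 1 can be subtracted from all `m + 1` parts.
-- The second case keeps the length but lowers the weight, hence a recursion on `n` inside that on
-- `m`.
card-Plain : ∀ m n → HasCard (OfLength m Plain at n) (1/qPochhammer m n)
card-Plain zero n = subst (HasCard (OfLength 0 Plain at n)) (sym (recip-1 n)) (base n)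
  where
  base : ∀ n → HasCard (OfLength 0 Plain at n) ((q^ 0) n)
  base zero    = card-singleton [] ((refl , [] , []) , refl) λ { {[]} _ → refl }
  base (suc n) = card-∅ λ { {[]} (_ , ()) ; {_ ∷ _} ((() , _) , _) }
card-Plain (suc m) = <-rec _ λ n rec →
  subst (HasCard (OfLength (suc m) Plain at n)) (sym (1/qPochhammer-suc m n))
    (card-⊎
      (card-image {OfLength m Plain} {0} (part 0 false ∷_) List.∷-injectiveʳ
        (λ _ → refl) (card-Plain m n))
      (card-shifted {OfLength (suc m) Plain} {suc m} (1/qPochhammer (suc m))
        grow-all grow-all-injective
        (λ {π} (len , _) → trans (∣grow-all∣ π) (cong (_+ ∣ π ∣) len)) n
        λ { n′ refl → rec (ℕ.m<n+m n′ (s≤s z≤n)) })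
      disjoint
      (λ { ((π , (refl , asc , non) , refl) , |π|) →
           (refl , All.map zero⊴ non ∷ asc , refl ∷ non) , |π| })
      (λ { ((π , (len , asc , non) , refl) , |π|) →
           (trans (List.length-map grow π) len , Ascending-grow⁺ asc , All.map⁺ non) , |π| })
      split)
  where
  disjoint : ∀ {n π} → (Image (part 0 false ∷_) (OfLength m Plain) at n) π →
             (Image grow-all (OfLength (suc m) Plain) at n) π → ⊥
  disjoint ((_ , _ , refl) , _) (([] , _ , ()) , _)
  disjoint ((_ , _ , refl) , _) ((_ ∷ _ , _ , ()) , _)

  split : ∀ {n π} → (OfLength (suc m) Plain at n) π →
    (Image (part 0 false ∷_) (OfLength m Plain) at n) π ⊎
    (Image grow-all (OfLength (suc m) Plain) at n) π
  split {π = part zero false ∷ π} ((refl , _ ∷ asc , _ ∷ non) , |π|) =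
    inj₁ ((π , (refl , asc , non) , refl) , |π|)
  split {π = part (suc s) b ∷ π} ((len , asc@(x⊴ ∷ _) , non) , |π|) = inj₂
    (image-grow (λ (asc , non) → Ascending-grow⁻ asc , All.map⁻ non)
      (s≤s z≤n ∷ positive-above (s≤s z≤n) x⊴) (len , asc , non) , |π|)

-- The counts of `PositiveMixed` are arguments because `card-PositiveMixed` obtains the first by
-- recursion on the weight and the second by recursion on the length.
card-Mixed : ∀ m n → HasCard (OfLength (suc m) PositiveMixed at n) (summand (suc m) n) →
  HasCard (OfLength m PositiveMixed at n) (summand m n) →
  HasCard (OfLength (suc m) Mixed at n) ((summand (suc m) ⊕ (summand m ⊕ 1/qPochhammer m)) n)
card-Mixed m n card-1+m card-m =
  card-⊎ card-1+m
    (card-⊎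
      {T = λ π → (Image (part 0 true ∷_) (OfLength m PositiveMixed) at n) π ⊎
                 (Image (part 0 false ∷_) (OfLength m Plain) at n) π}
      (card-image {OfLength m PositiveMixed} {0} (part 0 true ∷_) List.∷-injectiveʳ
        (λ _ → refl) card-m)
      (card-image {OfLength m Plain} {0} (part 0 false ∷_) List.∷-injectiveʳ
        (λ _ → refl) (card-Plain m n))
      (λ { ((_ , _ , refl) , _) ((_ , _ , ()) , _) })
      inj₁ inj₂ (λ x → x))
    (λ { ((_ , () ∷ _ , _) , _) (inj₁ ((_ , _ , refl) , _))
       ; ((_ , () ∷ _ , _) , _) (inj₂ ((_ , _ , refl) , _)) })
    (λ ((len , _ , mixed) , |π|) → (len , mixed) , |π|)
    (λ { (inj₁ ((_ , (refl , pos , asc , any) , refl) , |π|)) →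
         (refl , All.map zero̅⊴ pos ∷ asc , there any) , |π|
       ; (inj₂ ((_ , (refl , asc , non) , refl) , |π|)) →
         (refl , All.map zero⊴ non ∷ asc , here refl) , |π| })
    split
  where
  split : ∀ {π} → (OfLength (suc m) Mixed at n) π →
    (OfLength (suc m) PositiveMixed at n) π ⊎
    ((Image (part 0 true ∷_) (OfLength m PositiveMixed) at n) π ⊎
     (Image (part 0 false ∷_) (OfLength m Plain) at n) π)
  split {part (suc _) _ ∷ _} ((len , asc@(x⊴ ∷ _) , any) , |π|) =
    inj₁ ((len , s≤s z≤n ∷ positive-above (s≤s z≤n) x⊴ , asc , any) , |π|)
  -- By `overlined-<`, everything after an overlined 0 is positive, and the non-overlined part must
  -- lie in the tail.
  split {part zero true ∷ π} ((refl , x⊴ ∷ asc , there any) , |π|) =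
    inj₂ (inj₁ ((π , (refl , All.map (λ x⊴y → overlined-< x⊴y refl) x⊴ , asc , any) , refl) , |π|))
  -- By `overlined-⇐`, a non-overlined 0 forces all later parts to be non-overlined; further zeros
  -- may follow.
  split {part zero false ∷ π} ((refl , x⊴ ∷ asc , _) , |π|) =
    inj₂ (inj₂ ((π , (refl , asc , nonoverlined-above refl x⊴) , refl) , |π|))

card-PositiveMixed : ∀ m n → HasCard (OfLength m PositiveMixed at n) (summand m n)
card-PositiveMixed zero n = subst (HasCard (OfLength 0 PositiveMixed at n)) (sym (summand-0 n))
  (card-∅ λ { {[]} ((_ , _ , _ , ()) , _) ; {_ ∷ _} ((() , _) , _) })
card-PositiveMixed (suc m) = <-rec _ λ n rec →
  subst (HasCard (OfLength (suc m) PositiveMixed at n)) (sym (summand-suc m n))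
    -- The identity map only trades the image of `Mixed` under `grow-all` for `PositiveMixed`.
    (card-map (λ π → π) (λ eq → eq)
      (λ { ((π , (len , asc , any) , refl) , |π|) →
           (trans (List.length-map grow π) len ,
            All.map⁺ (All.universal (λ _ → s≤s z≤n) π) , Ascending-grow⁺ asc , Any.map⁺ any) , |π| })
      (λ ((len , pos , mixed) , |π|) → _ ,
        (image-grow (λ (asc , any) → Ascending-grow⁻ asc , Any.map⁻ any) pos (len , mixed) , |π|) , refl)
      (card-shifted {OfLength (suc m) Mixed} {suc m}
        (summand (suc m) ⊕ (summand m ⊕ 1/qPochhammer m))
        grow-all grow-all-injective
        (λ {π} (len , _) → trans (∣grow-all∣ π) (cong (_+ ∣ π ∣) len)) n
        λ { n′ refl → card-Mixed m n′ (rec (ℕ.m<n+m n′ (s≤s z≤n))) (card-PositiveMixed m n′) }))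

-- The list runs through the lengths `b`, ..., 1. Length 0 contributes nothing, since a
-- non-overlined part must occur.
card-≤length : ∀ b n → HasCard ((λ π → length π ≤ b × PositiveMixed π) at n)
                               (∑ℤ (map (λ m → summand m n) (applyDownFrom suc b)))
card-≤length zero    n = card-∅ λ { {[]} ((_ , _ , _ , ()) , _) ; {_ ∷ _} ((() , _) , _) }
card-≤length (suc b) n = card-⊎ (card-PositiveMixed (suc b) n) (card-≤length b n)
  (λ ((len , _) , _) ((len≤b , _) , _) → ℕ.<-irrefl len (s≤s len≤b))
  (λ ((len , mixed) , |π|) → (ℕ.≤-reflexive len , mixed) , |π|)
  (λ ((len≤b , mixed) , |π|) → (ℕ.m≤n⇒m≤1+n len≤b , mixed) , |π|)
  (λ ((len≤1+b , mixed) , |π|) → case ℕ.m≤n⇒m<n∨m≡n len≤1+b of λ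
    { (inj₁ len<1+b) → inj₂ ((s≤s⁻¹ len<1+b , mixed) , |π|)
    ; (inj₂ len)     → inj₁ ((len , mixed) , |π|) })

length≤weight : ∀ {π} → All Positive π → length π ≤ ∣ π ∣
length≤weight []          = z≤n
length≤weight (pos ∷ all) = ℕ.+-mono-≤ pos (length≤weight all)

-- Reversal

module _ {A : Set} where

  AllPairs-reverse : ∀ {R : A → A → Set} {xs} → AllPairs R xs → AllPairs (flip R) (reverse xs)
  AllPairs-reverse [] = []
  AllPairs-reverse {R} {x ∷ xs} (x~ ∷ pairs) =
    subst (AllPairs (flip R)) (sym (List.unfold-reverse x xs))
      (AllPairs.++⁺ (AllPairs-reverse pairs) ([] ∷ [])
        (All.map (_∷ []) (↭.All-resp-↭ (↭-sym (↭.↭-reverse xs)) x~)))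

  All-reverse : ∀ {P : A → Set} {xs} → All P xs → All P (reverse xs)
  All-reverse {xs = xs} = ↭.All-resp-↭ (↭-sym (↭.↭-reverse xs))

  ∈⇒AllPairs : ∀ {R : A → A → Set} {xs} → (∀ {x y} → x ∈ xs → y ∈ xs → R x y) → AllPairs R xs
  ∈⇒AllPairs {xs = []}     R∈ = []
  ∈⇒AllPairs {xs = x ∷ xs} R∈ =
    All.tabulate (R∈ (here refl) ∘ there) ∷ ∈⇒AllPairs (λ x∈ y∈ → R∈ (there x∈) (there y∈))

  AllPairs⇒∈ : ∀ {R : A → A → Set} {xs} → AllPairs R xs →
               ∀ {x y} → x ∈ xs → y ∈ xs → x ≡ y ⊎ (R x y ⊎ R y x)
  AllPairs⇒∈ (_ ∷ _)  (here refl) (here refl) = inj₁ refl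
  AllPairs⇒∈ (x~ ∷ _) (here refl) (there y∈)  = inj₂ (inj₁ (All.lookup x~ y∈))
  AllPairs⇒∈ (y~ ∷ _) (there x∈)  (here refl) = inj₂ (inj₂ (All.lookup y~ x∈))
  AllPairs⇒∈ (_ ∷ ~)  (there x∈)  (there y∈)  = AllPairs⇒∈ ~ x∈ y∈

∣reverse∣ : ∀ π → ∣ reverse π ∣ ≡ ∣ π ∣
∣reverse∣ π = sum-↭ (↭.map⁺ size (↭.↭-reverse π))

-- The three pairwise conditions yield the fields of `_⊴_`: monotonicity gives `size-≤`,
-- `first-overlined` excludes equality and gives `overlined-<`, and a non-overlined part after an
-- overlined one would be both larger and not larger, which gives `overlined-⇐`.
G-O-N⇒PositiveMixed : ∀ {π} → G-O-N π → PositiveMixed (reverse π)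
G-O-N⇒PositiveMixed {π} g =
  All-reverse positive ,
  AllPairs-reverse (AllPairs.map descending
    (AllPairs.zip (nonincreasing , AllPairs.zip (first-overlined , ∈⇒AllPairs separated)))) ,
  Any.reverse⁺ has-nonoverlined
  where
  open G-O-N g
  open IsOverpartition isOverpartition

  separated : ∀ {x y} → x ∈ π → y ∈ π →
              overlined y ≡ false → overlined x ≡ true → size x < size y
  separated x∈ y∈ = nonoverlined>overlined y∈ x∈

  descending : ∀ {x y} → size y ≤ size x ×
    (overlined y ≡ true → size x ≢ size y) ×
    (overlined y ≡ false → overlined x ≡ true → size x < size y) → y ⊴ x
  descending {x} {part t b} (t≤x , first , sep) = record
    { size-≤      = t≤x
    ; overlined-< = λ over → ℕ.≤∧≢⇒< t≤x (first over ∘ sym)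
    ; overlined-⇐ = λ over → overlined-if b sep over
    }
    where
    overlined-if : ∀ b → (b ≡ false → overlined x ≡ true → size x < t) →
                   overlined x ≡ true → b ≡ true
    overlined-if true  _   _    = refl
    overlined-if false sep over = contradiction t≤x (ℕ.<⇒≱ (sep refl over))

PositiveMixed⇒G-O-N : ∀ {π} → PositiveMixed π → G-O-N (reverse π)
PositiveMixed⇒G-O-N {π} (pos , asc , any) = record
  { isOverpartition = record
    { positive        = All-reverse pos
    ; nonincreasing   = AllPairs.map size-≤ desc
    ; first-overlined = AllPairs.map (λ y⊴x over → ℕ.>⇒≢ (overlined-< y⊴x over)) desc
    }
  ; has-nonoverlined       = Any.reverse⁺ any
  ; nonoverlined>overlined = λ x∈ y∈ → separated (AllPairs⇒∈ desc x∈ y∈)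
  }
  where
  desc : AllPairs (flip _⊴_) (reverse π)
  desc = AllPairs-reverse asc

  separated : ∀ {x y} → x ≡ y ⊎ (y ⊴ x ⊎ x ⊴ y) →
              overlined x ≡ false → overlined y ≡ true → size y < size x
  separated (inj₁ refl)       non over with () ← trans (sym non) over
  separated (inj₂ (inj₁ y⊴x)) non over = overlined-< y⊴x over
  -- Here the overlined `y` comes first in the non-increasing order, which would make `x` overlined
  -- too.
  separated (inj₂ (inj₂ x⊴y)) non over with () ← trans (sym non) (overlined-⇐ x⊴y over)

-- Summation over the number of parts

-- Stopping at `m = n` loses nothing: `length≤weight` shows it for the overpartitions, `summand-<`
-- for the series.
total : PowerSeries
total n = ∑ℤ (map (λ m → summand m n) (applyDownFrom suc n))

card-G-O-N : ∀ n → HasCard (G-O-N at n) (total n)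
card-G-O-N n = card-map reverse List.reverse-injective
  (λ { {π} ((_ , mixed) , |π|) → PositiveMixed⇒G-O-N mixed , trans (∣reverse∣ π) |π| })
  (λ { {π} (g , refl) → let mixed = G-O-N⇒PositiveMixed g in
       reverse π ,
       ((subst (length (reverse π) ≤_) (∣reverse∣ π) (length≤weight (proj₁ mixed)) , mixed) ,
        ∣reverse∣ π) ,
       List.reverse-involutive π })
  (card-≤length n n)

∑-weights : ∀ n {πs} → All (λ π → ∣ π ∣ ≡ n) πs →
            ∑ℤ (map (λ π → (q^ ∣ π ∣) n) πs) ≡ ℤ.+ length πs
∑-weights n []           = refl
∑-weights n (refl ∷ all) = cong₂ ℤ._+_ (q^-self n) (∑-weights n all)

-- The members with a nonzero coefficient of `q^n` are those of weight `n`, and each contributes 1,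
-- so an enumeration of them is the finite index set required.
HasCard⇒≐ : ∀ {P S} → (∀ n → HasCard (P at n) (S n)) → ∑[ P ] (λ π → q^ ∣ π ∣) ≐ S
HasCard⇒≐ card n =
  let (πs , πs! , πs⊆ , ⊆πs , |πs|) = card n in
  πs , πs! , All.tabulate (proj₁ ∘ πs⊆) ,
  (λ π p ≢0 → ⊆πs (p , q^-≢0 ≢0)) ,
  trans (sym |πs|) (sym (∑-weights n (All.tabulate (proj₂ ∘ πs⊆))))

summand-≐ : ∑[ (1 ≤_) ] summand ≐ total
summand-≐ n =
  applyDownFrom suc n ,
  Unique.applyDownFrom⁺₁ suc n (λ j<i _ → ℕ.>⇒≢ (s≤s j<i)) ,
  All.applyDownFrom⁺₂ suc n (λ _ → s≤s z≤n) ,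
  (λ { (suc m) _ ≢0 → ∈.∈-applyDownFrom⁺ suc (ℕ.≮⇒≥ (≢0 ∘ summand-<)) }) ,
  refl

mainTheorem7 : ∃[ S ]
    (∑[ G-O-N ] (λ π → q^ ∣ π ∣) ≐ S) ×
    (∑[ (λ m → 1 ≤ m) ] (λ m → recip (qPochhammer m) ⊗ ∑< m (λ k → q^ ((k + 1) * m ∸ (k + 1) C 2))) ≐ S)
mainTheorem7 = total , HasCard⇒≐ card-G-O-N , summand-≐
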